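{- For every graph $G$ and every input divisor $D$ on $G$, the Modified Dhar's Burning Algorithm (defined in the context) terminates.
   Context: All graphs are finite, connected, loopless multigraphs with nonempty vertex set $V(G)$. A divisor on $G$ is an element $D=\sum_v D(v)\cdot v$ of the free abelian group on $V(G)$; $D\ge 0$ (effective) means $D(v)\ge 0$ for all $v$. Write $D=D^+-D^-$ with $D^+(v)=\max\{D(v),0\}$, $D^-(v)=\max\{ -D(v),0\}$, and let $\mathrm{supp}(D^-)=\{v: D(v)<0\}$. For $W\subseteq V(G)$ and $v\in W$, $\mathrm{outdeg}_W(v)$ is the number of edges from $v$ to $V(G)\setminus W$. Let $\Delta:\mathbb{Z}^{V(G)}\to \mathrm{Div}(G)$ be the map given by the Laplacian matrix (diagonal entries the valences $\mathrm{val}(v)$, off-diagonal entries minus the number of edges between the two vertices), and let $\mathbb{1}_W$ be the indicator function of $W$; replacing $D$ by $D-\Delta\mathbb{1}_W$ is called firing $W$ (one chip is sent along each edge from $W$ to $V(G)\setminus W$). Modified Dhar's Burning Algorithm, on input a divisor $D$: (1) If $D\ge 0$, return $D$. (2) Set $W:=V(G)\setminus\mathrm{supp}(D^-)$. (3) While $W\neq\emptyset$: if there is some $v\in W$ with $D(v)<\mathrm{outdeg}_W(v)$, replace $W$ by $W\setminus\{v\}$; otherwise, call the algorithm recursively on $D-\Delta\mathbb{1}_W$ and return its result. (4) If $W=\emptyset$ is reached, return NONE. -}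

module Defs where

open import Algebra.Properties.CommutativeMonoid.Sum as Sum using ()
open import Data.Bool.Base using (if_then_else_)
open import Data.Fin.Base using (Fin)
open import Data.Fin.Properties using () renaming (_≟_ to _≟ᶠ_)
open import Data.Fin.Subset using (Subset; _∈_; ∁; _-_; Nonempty; Empty)
open import Data.Integer.Base as ℤ using (ℤ; +_; 0ℤ; 1ℤ)
open import Data.Integer.Properties as ℤₚ using ()
open import Data.Maybe.Base using (Maybe; just; nothing)
open import Data.Nat.Base as ℕ using (ℕ; NonZero)
open import Data.Nat.Properties as ℕₚ using ()
open import Data.Product.Base using (∃; _×_)
open import Data.Sum.Base using (_⊎_)
open import Data.Vec.Base using (lookup; tabulate)
open import Data.Vec.Functional using (Vector)
open import Function.Base using (flip)
open import Induction.WellFounded using (Acc)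
open import Relation.Binary.Construct.Closure.ReflexiveTransitive using (Star)
open import Relation.Binary.PropositionalEquality.Core using (_≡_)
open import Relation.Nullary.Decidable.Core using (does)
open import Relation.Nullary.Negation.Core using (¬_)

open Sum ℕₚ.+-0-commutativeMonoid using () renaming (sum to sumℕ)
open Sum ℤₚ.+-0-commutativeMonoid using () renaming (sum to sumℤ)

-- A finite multigraph is given by its edge multiplicities: mult u v is the
-- number of edges joining u and v.
record Multigraph : Set where
  field
    order     : ℕ
    nonempty  : NonZero order
    mult      : Fin order → Fin order → ℕ
    symmetric : ∀ u v → mult u v ≡ mult v u
    loopless  : ∀ v → mult v v ≡ 0

  Vertex : Set
  Vertex = Fin order

  Adjacent : Vertex → Vertex → Set
  Adjacent u v = 0 ℕ.< mult u v

  field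
    connected : ∀ u v → Star Adjacent u v

module _ (G : Multigraph) where
  open Multigraph G

  Divisor : Set
  Divisor = Vector ℤ order

  Effective : Divisor → Set
  Effective D = ∀ v → 0ℤ ℤ.≤ D v

  -- supp(D⁻) = { v : D(v) < 0 }
  negSupport : Divisor → Subset order
  negSupport D = tabulate λ v → does (D v ℤₚ.<? 0ℤ)

  val : Vertex → ℕ
  val v = sumℕ (mult v)

  outdeg : Subset order → Vertex → ℕ
  outdeg W v = sumℕ λ u → if lookup W u then 0 else mult v u

  laplacian : Vertex → Vertex → ℤ
  laplacian v u = if does (v ≟ᶠ u) then + val v else ℤ.- (+ mult v u)

  Δ : Vector ℤ order → Divisor
  Δ f v = sumℤ λ u → laplacian v u ℤ.* f u

  𝟙 : Subset order → Vector ℤ order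
  𝟙 W v = if lookup W v then 1ℤ else 0ℤ

  fire : Subset order → Divisor → Divisor
  fire W D v = D v ℤ.- Δ (𝟙 W) v

  -- Since the recursive call is a tail call, no call stack is recorded:
  --   call D    the algorithm has just been called on D;
  --   loop D W  control is at the head of the while loop;
  --   return r  the algorithm has returned r, where nothing stands for NONE.
  data State : Set where
    call   : Divisor → State
    loop   : Divisor → Subset order → State
    return : Maybe Divisor → State

  infix 4 _⟶_

  -- The relation is nondeterministic: burn may remove any vertex of W that
  -- satisfies the condition.
  data _⟶_ : State → State → Set where
    effective : ∀ {D} → Effective D →
                call D ⟶ return (just D)
    start     : ∀ {D} → ¬ Effective D →
                call D ⟶ loop D (∁ (negSupport D))
    burn      : ∀ {D W v} → v ∈ W → D v ℤ.< + outdeg W v →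
                loop D W ⟶ loop D (W - v)
    recurse   : ∀ {D W} → Nonempty W →
                (∀ v → v ∈ W → ¬ (D v ℤ.< + outdeg W v)) →
                loop D W ⟶ call (fire W D)
    exhausted : ∀ {D W} → Empty W →
                loop D W ⟶ return nothing

  HasReturned : State → Set
  HasReturned s = ∃ λ r → s ≡ return r

  -- Every run from s is finite, and a run can only stop by returning:
  -- accessibility is with respect to "is a successor of", so it excludes
  -- infinite runs whatever choices are made.
  Terminates : State → Set
  Terminates s =
    Acc (flip _⟶_) s ×
    (∀ {t} → Star _⟶_ s t → HasReturned t ⊎ ∃ λ t′ → t ⟶ t′)

{-# OPTIONS --safe #-}

-- Fix q with D(q) < 0.  As long as q stays in debt it is never fired, so all
-- firings take place away from q.  There is a weight c ≥ 0 on the vertices with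
-- (Δ c)(w) > 0 for every w ≠ q: take c = H − h, where h(v) decays geometrically,
-- with large ratio, in the distance from v to q.  Since Δ is self-adjoint,
-- firing a nonempty W ∌ q changes Σ c(v) D(v) by −Σ_{w ∈ W} (Δ c)(w) < 0, and a
-- legal firing changes Σ c(v) D⁺(v) by at most as much.  Vertices never enter
-- debt, so the sum over all q in debt of 1 + Σ c_q(v) D⁺(v) decreases strictly
-- with every recursive call.
module Submission where

open import Defs

open import Algebra.Properties.Semiring.Sum as SemiringSum using ()
open import Data.Bool.Base using (true; false; if_then_else_)
open import Data.Fin.Base using (Fin; zero; suc)
open import Data.Fin.Properties using (any?; all?; ¬∀⟶∃¬) renaming (_≟_ to _≟ᶠ_)
open import Data.Fin.Subset using (Subset; _∈_; _∉_; ∁; _-_; ⁅_⁆; Nonempty; ∣_∣)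
open import Data.Fin.Subset.Properties
  using (_∈?_; nonempty?; x∈∁p⇒x∉p; p─q⊆p; x∈p⇒∣p-x∣<∣p∣)
open import Data.Integer.Base as ℤ using (ℤ; +_; 0ℤ; 1ℤ; _⊔_; nonNegative)
open import Data.Integer.Properties as ℤₚ using ()
open import Data.Integer.Tactic.RingSolver using (solve-∀)
open import Data.Nat.Base as ℕ using (ℕ; zero; suc; z≤n; s≤s; _∸_; _^_)
open import Data.Nat.Induction using (<-wellFounded)
open import Data.Nat.Properties as ℕₚ using ()
open import Data.Product.Base using (∃; _×_; _,_; proj₁; proj₂)
open import Data.Sum.Base using (_⊎_; inj₁; inj₂)
open import Data.Vec.Base using (lookup)
open import Data.Vec.Functional using (Vector)
open import Data.Vec.Properties using ([]=⇒lookup; lookup⇒[]=; lookup∘tabulate)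
open import Function.Base using (_∘_; flip)
open import Induction.WellFounded using (Acc; acc)
open import Relation.Binary.Construct.Closure.ReflexiveTransitive using (Star; ε; _◅_)
open import Relation.Binary.PropositionalEquality
  using (_≡_; _≢_; refl; sym; trans; cong; cong₂; subst; subst₂; module ≡-Reasoning)
open import Relation.Nullary using (¬_; Dec; yes; no; does; contradiction)
open import Relation.Nullary.Decidable using (dec-true; _×-dec_)
open import Relation.Unary using (Decidable)

open SemiringSum ℤₚ.+-*-semiring
  using (sum-cong-≗; sum-replicate-zero; ∑-distrib-+; ∑-comm; *-distribˡ-sum)
  renaming (sum to sumℤ)
open SemiringSum ℕₚ.+-*-semiring using ()
  renaming (sum to sumℕ; *-distribʳ-sum to *-distribʳ-sumℕ)

-- Finite sums

sumℤ-mono-≤ : ∀ {n} {f g : Vector ℤ n} → (∀ i → f i ℤ.≤ g i) → sumℤ f ℤ.≤ sumℤ g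
sumℤ-mono-≤ {zero}  f≤g = ℤₚ.≤-refl
sumℤ-mono-≤ {suc n} f≤g = ℤₚ.+-mono-≤ (f≤g zero) (sumℤ-mono-≤ (f≤g ∘ suc))

sumℤ-mono-< : ∀ {n} {f g : Vector ℤ n} → (∀ i → f i ℤ.≤ g i) →
              ∀ i → f i ℤ.< g i → sumℤ f ℤ.< sumℤ g
sumℤ-mono-< f≤g zero    fi<gi = ℤₚ.+-mono-<-≤ fi<gi (sumℤ-mono-≤ (f≤g ∘ suc))
sumℤ-mono-< f≤g (suc i) fi<gi = ℤₚ.+-mono-≤-< (f≤g zero) (sumℤ-mono-< (f≤g ∘ suc) i fi<gi)

sumℤ-nonNeg : ∀ {n} {f : Vector ℤ n} → (∀ i → 0ℤ ℤ.≤ f i) → 0ℤ ℤ.≤ sumℤ f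
sumℤ-nonNeg {n} {f} 0≤f = subst (ℤ._≤ sumℤ f) (sum-replicate-zero n) (sumℤ-mono-≤ 0≤f)

sumℤ-nonPos : ∀ {n} {f : Vector ℤ n} → (∀ i → f i ℤ.≤ 0ℤ) → sumℤ f ℤ.≤ 0ℤ
sumℤ-nonPos {n} {f} f≤0 = subst (sumℤ f ℤ.≤_) (sum-replicate-zero n) (sumℤ-mono-≤ f≤0)

sumℤ-pos : ∀ {n} {f : Vector ℤ n} → (∀ i → 0ℤ ℤ.≤ f i) → ∀ i → 0ℤ ℤ.< f i → 0ℤ ℤ.< sumℤ f
sumℤ-pos {n} {f} 0≤f i 0<fi = subst (ℤ._< sumℤ f) (sum-replicate-zero n) (sumℤ-mono-< 0≤f i 0<fi)

sumℤ-neg : ∀ {n} (f : Vector ℤ n) → sumℤ (λ i → ℤ.- f i) ≡ ℤ.- sumℤ f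
sumℤ-neg {zero}  f = refl
sumℤ-neg {suc n} f =
  trans (cong (λ x → (ℤ.- f zero) ℤ.+ x) (sumℤ-neg (f ∘ suc))) (sym (ℤₚ.neg-distrib-+ (f zero) _))

sumℤ-sub : ∀ {n} (f g : Vector ℤ n) → sumℤ (λ i → f i ℤ.- g i) ≡ sumℤ f ℤ.- sumℤ g
sumℤ-sub f g = trans (∑-distrib-+ f (ℤ.-_ ∘ g)) (cong (λ x → sumℤ f ℤ.+ x) (sumℤ-neg g))

sumℤ-δ : ∀ {n} (v : Fin n) x → sumℤ (λ u → if does (v ≟ᶠ u) then x else 0ℤ) ≡ x
sumℤ-δ {suc n} zero    x = trans (cong (λ y → x ℤ.+ y) (sum-replicate-zero n)) (ℤₚ.+-identityʳ x)
sumℤ-δ {suc n} (suc v) x = trans (ℤₚ.+-identityˡ _) (sumℤ-δ v x)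

pos-sum : ∀ {n} (f : Vector ℕ n) → + sumℕ f ≡ sumℤ (+_ ∘ f)
pos-sum {zero}  f = refl
pos-sum {suc n} f = trans (ℤₚ.pos-+ (f zero) _) (cong (λ x → + f zero ℤ.+ x) (pos-sum (f ∘ suc)))

term≤sum : ∀ {n} (f : Vector ℕ n) i → f i ℕ.≤ sumℕ f
term≤sum f zero    = ℕₚ.m≤m+n _ _
term≤sum f (suc i) = ℕₚ.≤-trans (term≤sum (f ∘ suc) i) (ℕₚ.m≤n+m _ _)

least : ∀ {p} {P : ℕ → Set p} → Decidable P → ∀ n → P n →
        ∃ λ m → P m × (∀ k → P k → m ℕ.≤ k)
least P? n Pn with P? 0
... | yes P0 = 0 , P0 , λ _ _ → z≤n
least P? zero    Pn | no ¬P0 = contradiction Pn ¬P0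
least P? (suc n) Pn | no ¬P0 with least (P? ∘ suc) n Pn
... | m , Pm , m≤ = suc m , Pm , λ where
  zero    P0 → contradiction P0 ¬P0
  (suc k) Pk → s≤s (m≤ k Pk)

∉⇒lookup : ∀ {n} {p : Subset n} {v} → v ∉ p → lookup p v ≡ false
∉⇒lookup {p = p} {v} v∉p with lookup p v in eq
... | true  = contradiction (lookup⇒[]= v p eq) v∉p
... | false = refl

module _ (G : Multigraph) where
  open Multigraph G

  -- The Laplacian

  -- On the diagonal the subtracted multiplicity is zero, because there are no loops. The uniform
  -- second term lets row sums be separated into two sums.
  laplacian-split : ∀ v u →
    laplacian G v u ≡ (if does (v ≟ᶠ u) then + val G v else 0ℤ) ℤ.- + mult v u
  laplacian-split v u with v ≟ᶠ u
  ... | yes refl rewrite loopless v = sym (ℤₚ.+-identityʳ _)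
  ... | no  _    = sym (ℤₚ.+-identityˡ _)

  laplacian-sym : ∀ v u → laplacian G v u ≡ laplacian G u v
  laplacian-sym v u with v ≟ᶠ u | u ≟ᶠ v
  ... | yes refl | yes _   = refl
  ... | yes refl | no  v≢v = contradiction refl v≢v
  ... | no  v≢v  | yes refl = contradiction refl v≢v
  ... | no  _    | no  _   = cong (ℤ.-_ ∘ +_) (symmetric v u)

  -- Rows of the Laplacian sum to zero, since the valence is the sum of the multiplicities. In this
  -- form additive constants in `f` visibly drop out.
  Δ-differences : ∀ f v → Δ G f v ≡ sumℤ λ u → + mult v u ℤ.* (f v ℤ.- f u)
  Δ-differences f v = begin
    sumℤ (λ u → laplacian G v u ℤ.* f u)
      ≡⟨ sum-cong-≗ pointwise ⟩
    sumℤ (λ u → δ u ℤ.- + mult v u ℤ.* f u)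
      ≡⟨ sumℤ-sub δ (λ u → + mult v u ℤ.* f u) ⟩
    sumℤ δ ℤ.- sumℤ (λ u → + mult v u ℤ.* f u)
      ≡⟨ cong (ℤ._- sumℤ (λ u → + mult v u ℤ.* f u)) diagonal ⟩
    sumℤ (λ u → + mult v u ℤ.* f v) ℤ.- sumℤ (λ u → + mult v u ℤ.* f u)
      ≡⟨ sumℤ-sub (λ u → + mult v u ℤ.* f v) (λ u → + mult v u ℤ.* f u) ⟨
    sumℤ (λ u → + mult v u ℤ.* f v ℤ.- + mult v u ℤ.* f u)
      ≡⟨ sum-cong-≗ (λ u → factor (+ mult v u) (f v) (f u)) ⟩
    sumℤ (λ u → + mult v u ℤ.* (f v ℤ.- f u)) ∎
    where
    open ≡-Reasoning

    δ : Vertex → ℤ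
    δ u = if does (v ≟ᶠ u) then f v ℤ.* + val G v else 0ℤ

    factor : ∀ a b c → a ℤ.* b ℤ.- a ℤ.* c ≡ a ℤ.* (b ℤ.- c)
    factor = solve-∀

    swap : ∀ a b c → (a ℤ.- b) ℤ.* c ≡ c ℤ.* a ℤ.- b ℤ.* c
    swap = solve-∀

    pointwise : ∀ u → laplacian G v u ℤ.* f u ≡ δ u ℤ.- + mult v u ℤ.* f u
    pointwise u rewrite laplacian-split v u with v ≟ᶠ u
    ... | yes refl = swap (+ val G v) (+ mult v v) (f v)
    ... | no  _    = trans (swap 0ℤ (+ mult v u) (f u))
                           (cong (ℤ._- + mult v u ℤ.* f u) (ℤₚ.*-zeroʳ (f u)))

    diagonal : sumℤ δ ≡ sumℤ λ u → + mult v u ℤ.* f v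
    diagonal = begin
      sumℤ δ                                ≡⟨ sumℤ-δ v _ ⟩
      f v ℤ.* + val G v                     ≡⟨ cong (f v ℤ.*_) (pos-sum (mult v)) ⟩
      f v ℤ.* sumℤ (λ u → + mult v u)       ≡⟨ *-distribˡ-sum (f v) (λ u → + mult v u) ⟩
      sumℤ (λ u → f v ℤ.* + mult v u)       ≡⟨ sum-cong-≗ (λ u → ℤₚ.*-comm (f v) (+ mult v u)) ⟩
      sumℤ (λ u → + mult v u ℤ.* f v)       ∎

  Δ-selfAdjoint : ∀ f g → sumℤ (λ v → f v ℤ.* Δ G g v) ≡ sumℤ (λ v → g v ℤ.* Δ G f v)
  Δ-selfAdjoint f g = begin
    sumℤ (λ v → f v ℤ.* Δ G g v)
      ≡⟨ sum-cong-≗ (λ v → *-distribˡ-sum (f v) (λ u → laplacian G v u ℤ.* g u)) ⟩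
    sumℤ (λ v → sumℤ (λ u → f v ℤ.* (laplacian G v u ℤ.* g u)))
      ≡⟨ ∑-comm (λ v u → f v ℤ.* (laplacian G v u ℤ.* g u)) ⟩
    sumℤ (λ u → sumℤ (λ v → f v ℤ.* (laplacian G v u ℤ.* g u)))
      ≡⟨ sum-cong-≗ (λ u → sum-cong-≗ (λ v → transpose u v)) ⟩
    sumℤ (λ u → sumℤ (λ v → g u ℤ.* (laplacian G u v ℤ.* f v)))
      ≡⟨ sum-cong-≗ (λ u → *-distribˡ-sum (g u) (λ v → laplacian G u v ℤ.* f v)) ⟨
    sumℤ (λ u → g u ℤ.* Δ G f u) ∎
    where
    open ≡-Reasoning

    rearrange : ∀ a b c → a ℤ.* (b ℤ.* c) ≡ c ℤ.* (b ℤ.* a)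
    rearrange = solve-∀

    transpose : ∀ u v → f v ℤ.* (laplacian G v u ℤ.* g u) ≡ g u ℤ.* (laplacian G u v ℤ.* f v)
    transpose u v rewrite laplacian-sym v u = rearrange (f v) (laplacian G u v) (g u)

  -- Edges within `W` join equal indicator values; each edge leaving `W` contributes a difference of
  -- one.
  Δ𝟙-inside : ∀ {W v} → v ∈ W → Δ G (𝟙 G W) v ≡ + outdeg G W v
  Δ𝟙-inside {W} {v} v∈W = begin
    Δ G (𝟙 G W) v
      ≡⟨ Δ-differences (𝟙 G W) v ⟩
    sumℤ (λ u → + mult v u ℤ.* (𝟙 G W v ℤ.- 𝟙 G W u))
      ≡⟨ sum-cong-≗ pointwise ⟩
    sumℤ (λ u → + (if lookup W u then 0 else mult v u))
      ≡⟨ pos-sum (λ u → if lookup W u then 0 else mult v u) ⟨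
    + outdeg G W v ∎
    where
    open ≡-Reasoning

    pointwise : ∀ u → + mult v u ℤ.* (𝟙 G W v ℤ.- 𝟙 G W u)
                    ≡ + (if lookup W u then 0 else mult v u)
    pointwise u rewrite []=⇒lookup v∈W with lookup W u
    ... | true  = ℤₚ.*-zeroʳ (+ mult v u)
    ... | false = ℤₚ.*-identityʳ (+ mult v u)

  -- Seen from outside `W`, every indicator difference is 0 or -1: such a vertex can only gain
  -- chips.
  Δ𝟙-outside : ∀ {W v} → v ∉ W → Δ G (𝟙 G W) v ℤ.≤ 0ℤ
  Δ𝟙-outside {W} {v} v∉W =
    subst (ℤ._≤ 0ℤ) (sym (Δ-differences (𝟙 G W) v)) (sumℤ-nonPos pointwise)
    where
    pointwise : ∀ u → + mult v u ℤ.* (𝟙 G W v ℤ.- 𝟙 G W u) ℤ.≤ 0ℤ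
    pointwise u rewrite ∉⇒lookup v∉W with lookup W u
    ... | true  = subst (+ mult v u ℤ.* ℤ.-1ℤ ℤ.≤_) (ℤₚ.*-zeroʳ (+ mult v u))
                        (ℤₚ.*-monoˡ-≤-nonNeg (+ mult v u) ℤ.-≤+)
    ... | false = ℤₚ.≤-reflexive (ℤₚ.*-zeroʳ (+ mult v u))

  -- Distance

  -- With the length fixed, existence of a walk is decidable by searching neighbours, as `least`
  -- requires.
  Walk : ℕ → Vertex → Vertex → Set
  Walk zero    v q = v ≡ q
  Walk (suc n) v q = ∃ λ u → Adjacent v u × Walk n u q

  walk? : ∀ q v → Decidable λ n → Walk n v q
  walk? q v zero    = v ≟ᶠ q
  walk? q v (suc n) = any? λ u → (0 ℕₚ.<? mult v u) ×-dec walk? q u n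

  star⇒walk : ∀ {v q} → Star Adjacent v q → ∃ λ n → Walk n v q
  star⇒walk ε        = 0 , refl
  star⇒walk (a ◅ as) with star⇒walk as
  ... | n , w = suc n , _ , a , w

  shortestWalk : ∀ q v → ∃ λ n → Walk n v q × (∀ k → Walk k v q → n ℕ.≤ k)
  shortestWalk q v with star⇒walk (connected v q)
  ... | n , w = least (walk? q v) n w

  dist : Vertex → Vertex → ℕ
  dist q v = proj₁ (shortestWalk q v)

  -- Take the second vertex of a shortest walk: the rest of that walk bounds its distance.
  closerNeighbour : ∀ {q v} → v ≢ q → ∃ λ u → Adjacent v u × dist q u ℕ.< dist q v
  closerNeighbour {q} {v} v≢q with shortestWalk q v
  ... | zero  , v≡q         , _ = contradiction v≡q v≢q
  ... | suc n , (u , a , w) , _ = u , a , s≤s (proj₂ (proj₂ (shortestWalk q u)) n w)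

  -- Weights with positive Laplacian away from q

  module _ (q : Vertex) where

    -- The sum of the valences bounds each of them, so `base` exceeds every valence; as a successor
    -- it also has nonzero powers.
    base : ℕ
    base = suc (sumℕ (val G))

    -- The sum of all distances bounds each distance, so the truncated subtraction is exact and
    -- every step closer to `q` multiplies the height by `base`.
    height : Vertex → ℕ
    height v = base ^ (sumℕ (dist q) ∸ dist q v)

    -- The total height serves as the constant H, because it dominates each single height.
    weight : Vertex → ℤ
    weight v = + sumℕ height ℤ.- + height v

    weight-nonNeg : ∀ v → 0ℤ ℤ.≤ weight v
    weight-nonNeg v = ℤₚ.i≤j⇒0≤j-i (ℤ.+≤+ (term≤sum height v))

    -- One neighbour closer to `q` is enough: its height is at least `base` times that of `w`, and
    -- `base` exceeds the valence of `w`.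
    height-subharmonic : ∀ {w} → w ≢ q →
      val G w ℕ.* height w ℕ.< sumℕ λ u → mult w u ℕ.* height u
    height-subharmonic {w} w≢q with closerNeighbour w≢q
    ... | u , a , du<dw = begin-strict
      val G w ℕ.* height w
        <⟨ ℕₚ.*-monoˡ-< (height w) {{ℕₚ.m^n≢0 base (sumℕ (dist q) ∸ dist q w)}} (s≤s (term≤sum (val G) w)) ⟩
      base ^ suc (sumℕ (dist q) ∸ dist q w)
        -- The strict drop in distance pays for the `suc` in the exponent.
        ≤⟨ ℕₚ.^-monoʳ-≤ base (ℕₚ.∸-monoʳ-< du<dw (term≤sum (dist q) w)) ⟩
      height u
        ≡⟨ ℕₚ.*-identityˡ (height u) ⟨
      1 ℕ.* height u
        ≤⟨ ℕₚ.*-monoˡ-≤ (height u) a ⟩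
      mult w u ℕ.* height u
        ≤⟨ term≤sum (λ u → mult w u ℕ.* height u) u ⟩
      sumℕ (λ u → mult w u ℕ.* height u) ∎
      where open ℕₚ.≤-Reasoning

    -- The constant cancels in the differences, and the minus sign before `height` reverses them.
    Δ-weight : ∀ w → Δ G weight w
      ≡ + sumℕ (λ u → mult w u ℕ.* height u) ℤ.- + (val G w ℕ.* height w)
    Δ-weight w = begin
      Δ G weight w
        ≡⟨ Δ-differences weight w ⟩
      sumℤ (λ u → + mult w u ℤ.* (weight w ℤ.- weight u))
        ≡⟨ sum-cong-≗ pointwise ⟩
      sumℤ (λ u → + (mult w u ℕ.* height u) ℤ.- + (mult w u ℕ.* height w))
        ≡⟨ sumℤ-sub (λ u → + (mult w u ℕ.* height u)) (λ u → + (mult w u ℕ.* height w)) ⟩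
      sumℤ (λ u → + (mult w u ℕ.* height u)) ℤ.- sumℤ (λ u → + (mult w u ℕ.* height w))
        ≡⟨ cong₂ ℤ._-_ (pos-sum λ u → mult w u ℕ.* height u)
                       (pos-sum λ u → mult w u ℕ.* height w) ⟨
      + sumℕ (λ u → mult w u ℕ.* height u) ℤ.- + sumℕ (λ u → mult w u ℕ.* height w)
        ≡⟨ cong (λ x → + sumℕ (λ u → mult w u ℕ.* height u) ℤ.- + x)
                (*-distribʳ-sumℕ (height w) (mult w)) ⟨
      + sumℕ (λ u → mult w u ℕ.* height u) ℤ.- + (val G w ℕ.* height w) ∎
      where
      open ≡-Reasoning

      expand : ∀ m H a b → m ℤ.* ((H ℤ.- a) ℤ.- (H ℤ.- b)) ≡ m ℤ.* b ℤ.- m ℤ.* a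
      expand = solve-∀

      pointwise : ∀ u → + mult w u ℤ.* (weight w ℤ.- weight u)
                      ≡ + (mult w u ℕ.* height u) ℤ.- + (mult w u ℕ.* height w)
      pointwise u rewrite ℤₚ.pos-* (mult w u) (height u) | ℤₚ.pos-* (mult w u) (height w) =
        expand (+ mult w u) (+ sumℕ height) (+ height w) (+ height u)

    Δ-weight-pos : ∀ {w} → w ≢ q → 0ℤ ℤ.< Δ G weight w
    Δ-weight-pos {w} w≢q = begin-strict
      0ℤ            ≡⟨ ℤₚ.+-inverseʳ y ⟨
      y ℤ.- y       <⟨ ℤₚ.+-monoˡ-< (ℤ.- y) (ℤ.+<+ (height-subharmonic w≢q)) ⟩
      x ℤ.- y       ≡⟨ Δ-weight w ⟨
      Δ G weight w  ∎
      where
      open ℤₚ.≤-Reasoning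

      x y : ℤ
      x = + sumℕ (λ u → mult w u ℕ.* height u)
      y = + (val G w ℕ.* height w)

    -- The weighted potential of a divisor

    potential : Divisor G → ℤ
    potential D = sumℤ λ v → weight v ℤ.* (D v ⊔ 0ℤ)

    potential-nonNeg : ∀ D → 0ℤ ℤ.≤ potential D
    potential-nonNeg D = sumℤ-nonNeg λ v →
      subst (ℤ._≤ weight v ℤ.* (D v ⊔ 0ℤ)) (ℤₚ.*-zeroʳ (weight v))
        (ℤₚ.*-monoˡ-≤-nonNeg (weight v) {{nonNegative (weight-nonNeg v)}} (ℤₚ.i≤j⊔i (D v) 0ℤ))

    -- Self-adjointness moves the Laplacian onto `weight`; what remains is its sum over `W`, where
    -- every term is positive because `W` avoids `q`.
    firing-gain-pos : ∀ {W} → Nonempty W → q ∉ W → 0ℤ ℤ.< sumℤ λ v → weight v ℤ.* Δ G (𝟙 G W) v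
    firing-gain-pos {W} (w , w∈W) q∉W =
      subst (0ℤ ℤ.<_) (Δ-selfAdjoint (𝟙 G W) weight) (sumℤ-pos nonNeg w pos)
      where
      pos-inside : ∀ {v} → v ∈ W → 0ℤ ℤ.< 𝟙 G W v ℤ.* Δ G weight v
      pos-inside {v} v∈W rewrite []=⇒lookup v∈W =
        subst (0ℤ ℤ.<_) (sym (ℤₚ.*-identityˡ (Δ G weight v)))
          (Δ-weight-pos {v} λ v≡q → q∉W (subst (_∈ W) v≡q v∈W))

      pos : 0ℤ ℤ.< 𝟙 G W w ℤ.* Δ G weight w
      pos = pos-inside w∈W

      nonNeg : ∀ v → 0ℤ ℤ.≤ 𝟙 G W v ℤ.* Δ G weight v
      nonNeg v with v ∈? W
      ... | yes v∈W = ℤₚ.<⇒≤ (pos-inside v∈W)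
      ... | no  v∉W rewrite ∉⇒lookup v∉W = ℤₚ.≤-refl

  -- Legal firings

  Legal : Divisor G → Subset order → Set
  Legal D W = ∀ v → v ∈ W → + outdeg G W v ℤ.≤ D v

  -- A vertex of `W` sends out no more chips than it holds, and a vertex outside `W` loses none.
  Δ𝟙≤D⁺ : ∀ {D W} → Legal D W → ∀ v → Δ G (𝟙 G W) v ℤ.≤ D v ⊔ 0ℤ
  Δ𝟙≤D⁺ {D} {W} legal v with v ∈? W
  ... | yes v∈W = subst (ℤ._≤ D v ⊔ 0ℤ) (sym (Δ𝟙-inside v∈W))
                    (ℤₚ.≤-trans (legal v v∈W) (ℤₚ.i≤i⊔j (D v) 0ℤ))
  ... | no  v∉W = ℤₚ.≤-trans (Δ𝟙-outside v∉W) (ℤₚ.i≤j⊔i (D v) 0ℤ)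

  -- The right-hand side bounds both arguments of the maximum. Equality can fail where received
  -- chips are absorbed by debt.
  fire⁺-bound : ∀ {D W} → Legal D W → ∀ v →
                fire G W D v ⊔ 0ℤ ℤ.≤ (D v ⊔ 0ℤ) ℤ.- Δ G (𝟙 G W) v
  fire⁺-bound {D} {W} legal v = ℤₚ.⊔-lub
    (ℤₚ.+-monoˡ-≤ (ℤ.- Δ G (𝟙 G W) v) (ℤₚ.i≤i⊔j (D v) 0ℤ))
    (ℤₚ.i≤j⇒0≤j-i (Δ𝟙≤D⁺ legal v))

  fire-nonNeg : ∀ {D W} → Legal D W → ∀ v → 0ℤ ℤ.≤ D v → 0ℤ ℤ.≤ fire G W D v
  fire-nonNeg {D} {W} legal v 0≤Dv =
    ℤₚ.i≤j⇒0≤j-i (subst (Δ G (𝟙 G W) v ℤ.≤_) (ℤₚ.i≥j⇒i⊔j≡i 0≤Dv) (Δ𝟙≤D⁺ legal v))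

  potential-fire : ∀ {D W} q → Legal D W → Nonempty W → q ∉ W →
                   potential q (fire G W D) ℤ.< potential q D
  potential-fire {D} {W} q legal ne q∉W = begin-strict
    sumℤ (λ v → c v ℤ.* (fire G W D v ⊔ 0ℤ))
      -- Multiplying the pointwise bound by `c v` uses that weights are nonnegative.
      ≤⟨ sumℤ-mono-≤ (λ v → ℤₚ.*-monoˡ-≤-nonNeg (c v)
           {{nonNegative (weight-nonNeg q v)}} (fire⁺-bound legal v)) ⟩
    sumℤ (λ v → c v ℤ.* ((D v ⊔ 0ℤ) ℤ.- Δ𝟙 v))
      ≡⟨ sum-cong-≗ (λ v → distrib (c v) (D v ⊔ 0ℤ) (Δ𝟙 v)) ⟩
    sumℤ (λ v → c v ℤ.* (D v ⊔ 0ℤ) ℤ.- c v ℤ.* Δ𝟙 v)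
      ≡⟨ sumℤ-sub (λ v → c v ℤ.* (D v ⊔ 0ℤ)) (λ v → c v ℤ.* Δ𝟙 v) ⟩
    potential q D ℤ.- sumℤ (λ v → c v ℤ.* Δ𝟙 v)
      <⟨ ℤₚ.+-monoʳ-< (potential q D) (ℤₚ.neg-mono-< (firing-gain-pos q ne q∉W)) ⟩
    potential q D ℤ.- 0ℤ
      ≡⟨ ℤₚ.+-identityʳ _ ⟩
    potential q D ∎
    where
    open ℤₚ.≤-Reasoning

    c Δ𝟙 : Vertex → ℤ
    c  = weight q
    Δ𝟙 = Δ G (𝟙 G W)

    distrib : ∀ a x y → a ℤ.* (x ℤ.- y) ≡ a ℤ.* x ℤ.- a ℤ.* y
    distrib = solve-∀

  -- The termination measure

  -- The added 1 forces a strict drop when `q` leaves debt, even if its potential was zero. Summing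
  -- over all debtors avoids fixing one that may later be paid off.
  debtTerm : Divisor G → Vertex → ℤ
  debtTerm D q = if does (D q ℤₚ.<? 0ℤ) then 1ℤ ℤ.+ potential q D else 0ℤ

  measure : Divisor G → ℤ
  measure D = sumℤ (debtTerm D)

  debtTerm-nonNeg : ∀ D q → 0ℤ ℤ.≤ debtTerm D q
  debtTerm-nonNeg D q with D q ℤₚ.<? 0ℤ
  ... | yes _ = ℤₚ.+-mono-≤ {0ℤ} {1ℤ} (ℤ.+≤+ z≤n) (potential-nonNeg q D)
  ... | no  _ = ℤₚ.≤-refl

  NonNegativeOn : Divisor G → Subset order → Set
  NonNegativeOn D W = ∀ v → v ∈ W → 0ℤ ℤ.≤ D v

  -- If `q` stays in debt its potential drops, as `q` cannot lie in `W`; if it leaves debt, the term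
  -- falls from at least 1 to 0.
  debtTerm-fire-< : ∀ {D W} → Legal D W → Nonempty W → NonNegativeOn D W →
                    ∀ q → D q ℤ.< 0ℤ → debtTerm (fire G W D) q ℤ.< debtTerm D q
  debtTerm-fire-< {D} {W} legal ne nonNeg q Dq<0
    rewrite dec-true (D q ℤₚ.<? 0ℤ) Dq<0 with fire G W D q ℤₚ.<? 0ℤ
  ... | yes _ = ℤₚ.+-monoʳ-< 1ℤ
                  (potential-fire q legal ne λ q∈W → ℤₚ.<⇒≱ Dq<0 (nonNeg q q∈W))
  ... | no  _ = ℤₚ.+-mono-<-≤ {0ℤ} {1ℤ} (ℤ.+<+ (s≤s z≤n)) (potential-nonNeg q D)

  debtTerm-fire-≤ : ∀ {D W} → Legal D W → Nonempty W → NonNegativeOn D W →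
                    ∀ q → debtTerm (fire G W D) q ℤ.≤ debtTerm D q
  debtTerm-fire-≤ {D} {W} legal ne nonNeg q = case (D q ℤₚ.<? 0ℤ)
    where
    case : Dec (D q ℤ.< 0ℤ) → debtTerm (fire G W D) q ℤ.≤ debtTerm D q
    case (yes Dq<0) = ℤₚ.<⇒≤ (debtTerm-fire-< legal ne nonNeg q Dq<0)
    case (no  Dq≮0) with fire G W D q ℤₚ.<? 0ℤ
    ... | yes D′q<0 = contradiction (fire-nonNeg legal q (ℤₚ.≮⇒≥ Dq≮0)) (ℤₚ.<⇒≱ D′q<0)
    -- The term after firing is 0 here.
    ... | no  _     = debtTerm-nonNeg D q

  someDebt : ∀ {D} → ¬ Effective G D → ∃ λ q → D q ℤ.< 0ℤ
  someDebt {D} ¬eff with ¬∀⟶∃¬ order _ (λ v → 0ℤ ℤₚ.≤? D v) ¬eff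
  ... | q , 0≰Dq = q , ℤₚ.≰⇒> 0≰Dq

  -- Some vertex is in debt and its term drops strictly, while no other term grows. Absolute values
  -- carry the nonnegative measure into ℕ, where descent is well-founded.
  measure-fire : ∀ {D W} → ¬ Effective G D → Legal D W → Nonempty W → NonNegativeOn D W →
                 ℤ.∣ measure (fire G W D) ∣ ℕ.< ℤ.∣ measure D ∣
  measure-fire {D} {W} ¬eff legal ne nonNeg with someDebt ¬eff
  ... | q , Dq<0 = ℤₚ.drop‿+<+ (subst₂ ℤ._<_ (sym (abs (fire G W D))) (sym (abs D))
    (sumℤ-mono-< (debtTerm-fire-≤ legal ne nonNeg) q (debtTerm-fire-< legal ne nonNeg q Dq<0)))
    where
    abs : ∀ E → + ℤ.∣ measure E ∣ ≡ measure E
    abs E = ℤₚ.0≤i⇒+∣i∣≡i (sumℤ-nonNeg (debtTerm-nonNeg E))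

  start-nonNegative : ∀ D → NonNegativeOn D (∁ (negSupport G D))
  start-nonNegative D v v∈ with D v ℤₚ.<? 0ℤ in eq
  ... | no  Dv≮0 = ℤₚ.≮⇒≥ Dv≮0
  ... | yes _    = contradiction
    (lookup⇒[]= v _ (trans (lookup∘tabulate (λ u → does (D u ℤₚ.<? 0ℤ)) v) (cong does eq)))
    (x∈∁p⇒x∉p v∈)

  -- Accessibility of states and progress

  Accessible : State G → Set
  Accessible = Acc (flip (_⟶_ G))

  -- Inner induction on the size of `W`: burning shrinks `W` and preserves nonnegativity on it,
  -- while a recursive call lowers the measure and is left to `rec`.
  loop-accessible : ∀ {D} → ¬ Effective G D →
    (∀ D′ → ℤ.∣ measure D′ ∣ ℕ.< ℤ.∣ measure D ∣ → Accessible (call D′)) →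
    ∀ W → NonNegativeOn D W → Acc ℕ._<_ ∣ W ∣ → Accessible (loop D W)
  loop-accessible {D} ¬eff rec W nonNeg (acc smaller) = acc λ where
    (burn {v = v} v∈W _) → loop-accessible ¬eff rec (W - v)
      (λ u u∈ → nonNeg u (p─q⊆p W ⁅ v ⁆ u∈)) (smaller (x∈p⇒∣p-x∣<∣p∣ v∈W))
    (recurse ne unburnable) → rec _
      (measure-fire ¬eff (λ v v∈W → ℤₚ.≮⇒≥ (unburnable v v∈W)) ne nonNeg)
    (exhausted _) → acc λ ()

  -- Outer induction on the measure; the initial `W` excludes all debtors, which establishes the
  -- loop invariant.
  call-accessible : ∀ D → Acc ℕ._<_ ℤ.∣ measure D ∣ → Accessible (call D)
  call-accessible D (acc smaller) = acc λ where
    (effective _)  → acc λ ()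
    (start ¬eff)   → loop-accessible ¬eff (λ D′ lt → call-accessible D′ (smaller lt))
      _ (start-nonNegative D) (<-wellFounded _)

  -- Every guard is decidable on a finite vertex set, and the guards of `call` and of `loop` each
  -- cover all cases.
  progress : ∀ s → HasReturned G s ⊎ ∃ λ t → _⟶_ G s t
  progress (return r) = inj₁ (r , refl)
  progress (call D) with all? (λ v → 0ℤ ℤₚ.≤? D v)
  ... | yes eff = inj₂ (_ , effective eff)
  ... | no ¬eff = inj₂ (_ , start ¬eff)
  progress (loop D W) with nonempty? W
  ... | no  empty = inj₂ (_ , exhausted empty)
  ... | yes ne with any? (λ v → (v ∈? W) ×-dec (D v ℤₚ.<? + outdeg G W v))
  ...   | yes (v , v∈W , lt) = inj₂ (_ , burn v∈W lt)
  ...   | no  unburnable     = inj₂ (_ , recurse ne λ v v∈W lt → unburnable (v , v∈W , lt))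

proposition6p2 : (G : Multigraph) (D : Divisor G) → Terminates G (call D)
proposition6p2 G D = call-accessible G D (<-wellFounded _) , λ {t} _ → progress G t
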